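{- There is a type inference procedure (algorithm) for $\vdash^{L\pi}$ which, given a process $P$, returns $\Gamma,w$ such that $\Gamma\vdash^{L\pi}P:w$ if and only if there exist $\Gamma',w'$ such that $\Gamma'\vdash^{L\pi}P:w'$.
   Context: **Processes.** Fix an infinite set of names $a,b,c,\dots,x,y,\dots$. Values: $v ::= \star \mid a$ ($\star$ a constant, $a$ a name). Processes: $P ::= \mathbf 0 \mid P_1|P_2 \mid \overline a\langle v\rangle \mid (\nu a)P \mid a(x).P \mid\, !a(x).P$. $(\nu a)P$ binds $a$ in $P$; $a(x).P$ and $!a(x).P$ bind $x$ in $P$. Processes are implicitly assumed written so that all bound names are pairwise distinct and different from the free names, with implicit $\alpha$-renaming whenever needed. **Types.** $T ::= \sharp^{k}T \mid \mathsf i^{k}T \mid \mathsf o^{k}T \mid \mathbb U$, with $k\in\mathbb N$. Subtyping $\le$ is the least reflexive and transitive relation such that: $\sharp^kT\le \mathsf i^kT$; $\sharp^kT\le\mathsf o^kT$; if $T\le S$ and $k_1\le k_2$ then $\mathsf i^{k_2}T\le\mathsf i^{k_1}S$; if $T\le S$ and $k_1\le k_2$ then $\mathsf o^{k_1}S\le\mathsf o^{k_2}T$. **Typing.** A typing environment $\Gamma$ is a partial map from names to types; $\Gamma,a:T$ is its extension, defined only when $a\notin\mathrm{dom}(\Gamma)$. Values: $\Gamma\vdash\star:\mathbb U$; $\Gamma\vdash a:T$ if $\Gamma(a)=T$; if $\Gamma\vdash a:T$ and $T\le U$ then $\Gamma\vdash a:U$. Processes ($\Gamma\vdash P:w$,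 $w\in\mathbb N$): - $\Gamma\vdash\mathbf 0:0$; - if $\Gamma\vdash a:\mathsf o^kT$ and $\Gamma\vdash v:T$ then $\Gamma\vdash\overline a\langle v\rangle:k$; - if $\Gamma\vdash a:\mathsf i^kT$ and $\Gamma,x:T\vdash P:w$ then $\Gamma\vdash a(x).P:w$; - if $\Gamma\vdash a:\mathsf i^kT$, $\Gamma,x:T\vdash P:w$ and $k>w$ then $\Gamma\vdash\,!a(x).P:0$; - if $\Gamma,a:T\vdash P:w$ then $\Gamma\vdash(\nu a)P:w$; - if $\Gamma\vdash P_1:w_1$ and $\Gamma\vdash P_2:w_2$ then $\Gamma\vdash P_1|P_2:\max(w_1,w_2)$. **Localised typing.** $\Gamma\vdash^{L\pi}P:w$ holds if $\Gamma\vdash P:w$ has a derivation in which, whenever a type of the form $\eta^{k}\eta'^{k'}T$ (with $\eta,\eta'\in\{\sharp,\mathsf i,\mathsf o\}$) occurs, $\eta'=\mathsf o$; that is, channels only carry $\mathbb U$ or $\mathsf o$-types. The procedure reports failure when no such $\Gamma',w'$ exist. -}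

module Defs where

open import Data.Bool using (if_then_else_)
open import Data.List using (List; []; _∷_; [_]; _++_; filter)
open import Data.List.Relation.Binary.Disjoint.Propositional using (Disjoint)
open import Data.List.Relation.Unary.Unique.Propositional using (Unique)
open import Data.Maybe using (Maybe; just; nothing)
open import Data.Nat using (ℕ; _≤_; _>_; _⊔_; _≟_)
open import Data.Product using (Σ-syntax; _×_)
open import Relation.Binary.PropositionalEquality using (_≡_)
open import Relation.Nullary using (¬?; does)

infix  4 _<:_ _⊑_ _⊢ᵛ_∶_ _⊢_∶_ _⊢ᴸ_∶_
infixl 5 _▷_∶_
infixr 6 _∥_

Name : Set
Name = ℕ

data Value : Set where
  ⋆    : Value
  name : Name → Value

data Process : Set where
  𝟎   : Process
  _∥_ : Process → Process → Process
  out : Name → Value → Process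
  ν   : Name → Process → Process
  inp : Name → Name → Process → Process
  rep : Name → Name → Process → Process

fnᵛ : Value → List Name
fnᵛ ⋆        = []
fnᵛ (name a) = [ a ]

_∖_ : List Name → Name → List Name
as ∖ x = filter (λ a → ¬? (a ≟ x)) as

fn : Process → List Name
fn 𝟎           = []
fn (P ∥ Q)     = fn P ++ fn Q
fn (out a v)   = a ∷ fnᵛ v
fn (ν a P)     = fn P ∖ a
fn (inp a x P) = a ∷ (fn P ∖ x)
fn (rep a x P) = a ∷ (fn P ∖ x)

-- One entry per binder, so that Unique (bn P) says that no two binders
-- of P use the same name.
bn : Process → List Name
bn 𝟎           = []
bn (P ∥ Q)     = bn P ++ bn Q
bn (out a v)   = []
bn (ν a P)     = a ∷ bn P
bn (inp a x P) = x ∷ bn P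
bn (rep a x P) = x ∷ bn P

-- The convention under which processes are written; every raw process
-- has an α-variant satisfying it.
WellNamed : Process → Set
WellNamed P = Unique (bn P) × Disjoint (bn P) (fn P)

data Cap : Set where
  ♯ i o : Cap

data Type : Set where
  chan : Cap → ℕ → Type → Type
  𝕌    : Type

data _<:_ : Type → Type → Set where
  <:-refl  : ∀ {T} → T <: T
  <:-trans : ∀ {T S U} → T <: S → S <: U → T <: U
  ♯<:i     : ∀ {k T} → chan ♯ k T <: chan i k T
  ♯<:o     : ∀ {k T} → chan ♯ k T <: chan o k T
  i<:i     : ∀ {k₁ k₂ T S} → T <: S → k₁ ≤ k₂ → chan i k₂ T <: chan i k₁ S
  o<:o     : ∀ {k₁ k₂ T S} → T <: S → k₁ ≤ k₂ → chan o k₁ S <: chan o k₂ T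

Env : Set
Env = Name → Maybe Type

_∉dom_ : Name → Env → Set
a ∉dom Γ = Γ a ≡ nothing

-- Every typing rule that uses an extension also requires a ∉dom Γ, so
-- an existing binding is never overwritten.
_▷_∶_ : Env → Name → Type → Env
(Γ ▷ a ∶ T) b = if does (b ≟ a) then just T else Γ b

data _⊢ᵛ_∶_ (Γ : Env) : Value → Type → Set where
  t-star : Γ ⊢ᵛ ⋆ ∶ 𝕌
  t-name : ∀ {a T} → Γ a ≡ just T → Γ ⊢ᵛ name a ∶ T
  t-sub  : ∀ {a T U} → Γ ⊢ᵛ name a ∶ T → T <: U → Γ ⊢ᵛ name a ∶ U

data _⊢_∶_ (Γ : Env) : Process → ℕ → Set where
  t-nil : Γ ⊢ 𝟎 ∶ 0
  t-out : ∀ {a v k T} →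
          Γ ⊢ᵛ name a ∶ chan o k T → Γ ⊢ᵛ v ∶ T →
          Γ ⊢ out a v ∶ k
  t-inp : ∀ {a x k T P w} →
          Γ ⊢ᵛ name a ∶ chan i k T → x ∉dom Γ → Γ ▷ x ∶ T ⊢ P ∶ w →
          Γ ⊢ inp a x P ∶ w
  t-rep : ∀ {a x k T P w} →
          Γ ⊢ᵛ name a ∶ chan i k T → x ∉dom Γ → Γ ▷ x ∶ T ⊢ P ∶ w → k > w →
          Γ ⊢ rep a x P ∶ 0
  t-res : ∀ {a T P w} →
          a ∉dom Γ → Γ ▷ a ∶ T ⊢ P ∶ w →
          Γ ⊢ ν a P ∶ w
  t-par : ∀ {P₁ P₂ w₁ w₂} →
          Γ ⊢ P₁ ∶ w₁ → Γ ⊢ P₂ ∶ w₂ →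
          Γ ⊢ P₁ ∥ P₂ ∶ w₁ ⊔ w₂

-- Occurrence of a type inside a type.
data _⊑_ (S : Type) : Type → Set where
  here  : S ⊑ S
  there : ∀ {η k T} → S ⊑ T → S ⊑ chan η k T

LocalType : Type → Set
LocalType T = ∀ {η k η′ k′ S} → chan η k (chan η′ k′ S) ⊑ T → η′ ≡ o

LocalEnv : Env → Set
LocalEnv Γ = ∀ {a T} → Γ a ≡ just T → LocalType T

-- A derivation is local when every type in every judgement in it is,
-- the types in the environments included.
Localᵛ : ∀ {Γ v T} → Γ ⊢ᵛ v ∶ T → Set
Localᵛ {Γ} {_} {T} t-star      = LocalEnv Γ × LocalType T
Localᵛ {Γ} {_} {T} (t-name _)  = LocalEnv Γ × LocalType T
Localᵛ {Γ} {_} {T} (t-sub d _) = LocalEnv Γ × LocalType T × Localᵛ d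

Local : ∀ {Γ P w} → Γ ⊢ P ∶ w → Set
Local {Γ} t-nil           = LocalEnv Γ
Local {Γ} (t-out d e)     = LocalEnv Γ × Localᵛ d × Localᵛ e
Local {Γ} (t-inp d _ e)   = LocalEnv Γ × Localᵛ d × Local e
Local {Γ} (t-rep d _ e _) = LocalEnv Γ × Localᵛ d × Local e
Local {Γ} (t-res _ d)     = LocalEnv Γ × Local d
Local {Γ} (t-par d e)     = LocalEnv Γ × Local d × Local e

_⊢ᴸ_∶_ : Env → Process → ℕ → Set
Γ ⊢ᴸ P ∶ w = Σ[ d ∈ Γ ⊢ P ∶ w ] Local d

{-# OPTIONS --safe #-}
module Submission where

-- A local type is a capability over a list of levels, since below the top every
-- capability is o. Typing can then be made syntax directed, except for the
-- types guessed at restrictions, and it is enough to bound these guesses. Let L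
-- collect the depths of the payloads and the levels that must be strictly below
-- another one. Applying n ↦ |{ m < n : m ∈ L }| to
-- all depths (truncating the types) and to all levels is monotone, keeps
-- successors of elements of L, and makes everything at most |L|, which is linear
-- in the process. So a typable process has a solution in a finite search space.

open import Data.Bool using (Bool; true; false; if_then_else_)
open import Data.List using (List; []; _∷_; [_]; _++_; length; map; take; foldr)
open import Data.List.Membership.Propositional using (_∈_)
open import Data.List.Membership.Propositional.Properties using (∈-++⁺ˡ; ∈-++⁺ʳ; ∈-filter⁺)
open import Data.List.Properties using (length-map; length-take; length-++)
open import Data.List.Relation.Binary.Subset.Propositional using (_⊆_)
open import Data.List.Relation.Unary.All as All using (All; []; _∷_)
open import Data.List.Relation.Unary.All.Properties using (++⁻ˡ; map⁺)
open import Data.List.Relation.Unary.AllPairs using ([]; _∷_)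
open import Data.List.Relation.Unary.Any using (here; there)
open import Data.List.Relation.Unary.Unique.Propositional using (Unique)
open import Data.Maybe using (Maybe; just; nothing; maybe)
open import Data.Nat using (ℕ; zero; suc; _+_; _⊔_; _≤_; _<_; z≤n; s≤s; _≟_; _≤?_; _≤′_; ≤′-refl; ≤′-step)
open import Data.Nat.Properties
  using (≤-refl; ≤-reflexive; ≤-trans; m≤n⇒m≤1+n; ≤⇒≤′; <⇒≤; <⇒≢; m⊓n≤m; m≤m⊔n; m≤n⊔m; ⊔-lub; anyUpTo?; module ≤-Reasoning)
open import Data.List.Membership.DecPropositional _≟_ using (_∈?_)
open import Data.Product using (Σ-syntax; ∃; ∃₂; _×_; _,_; proj₂; map₂; uncurry)
open import Function using (_∘_; id; case_of_)
open import Function.Bundles using (_⇔_; mk⇔)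
open import Level using (0ℓ)
open import Relation.Binary.PropositionalEquality
  using (_≡_; _≢_; refl; sym; trans; cong; cong₂; subst)
open import Relation.Nullary using (¬_; Dec; yes; no; does; ¬?; contradiction; _×-dec_)
open import Relation.Nullary.Decidable using (map′)
open import Relation.Unary using (Pred; Decidable; U)
open import Defs

infix  4 _⊴_ _≼_ _≼?_ _↝_ _∣_↝_
infixl 5 _[_≔_]

-- Subtyping without a transitivity rule.

data _⊴_ : Type → Type → Set where
  𝕌⊴𝕌 : 𝕌 ⊴ 𝕌
  ♯⊴♯ : ∀ {k T} → chan ♯ k T ⊴ chan ♯ k T
  ♯⊴i : ∀ {k l T S} → l ≤ k → T ⊴ S → chan ♯ k T ⊴ chan i l S
  ♯⊴o : ∀ {k l T S} → k ≤ l → S ⊴ T → chan ♯ k T ⊴ chan o l S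
  i⊴i : ∀ {k l T S} → l ≤ k → T ⊴ S → chan i k T ⊴ chan i l S
  o⊴o : ∀ {k l T S} → k ≤ l → S ⊴ T → chan o k T ⊴ chan o l S

⊴-refl : ∀ T → T ⊴ T
⊴-refl (chan ♯ k T) = ♯⊴♯
⊴-refl (chan i k T) = i⊴i ≤-refl (⊴-refl T)
⊴-refl (chan o k T) = o⊴o ≤-refl (⊴-refl T)
⊴-refl 𝕌            = 𝕌⊴𝕌

-- The rules `♯⊴i` and `♯⊴o` already absorb a following step at `i` or `o`, so two rules always
-- compose into one. Admissible transitivity makes `_<:_` invertible through `<:⇒⊴`.
⊴-trans : ∀ {T S V} → T ⊴ S → S ⊴ V → T ⊴ V
⊴-trans 𝕌⊴𝕌       q           = q
⊴-trans ♯⊴♯       q           = q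
⊴-trans (♯⊴i p d) (i⊴i q e)   = ♯⊴i (≤-trans q p) (⊴-trans d e)
⊴-trans (♯⊴o p d) (o⊴o q e)   = ♯⊴o (≤-trans p q) (⊴-trans e d)
⊴-trans (i⊴i p d) (i⊴i q e)   = i⊴i (≤-trans q p) (⊴-trans d e)
⊴-trans (o⊴o p d) (o⊴o q e)   = o⊴o (≤-trans p q) (⊴-trans e d)

<:⇒⊴ : ∀ {T S} → T <: S → T ⊴ S
<:⇒⊴ <:-refl        = ⊴-refl _
<:⇒⊴ (<:-trans p q) = ⊴-trans (<:⇒⊴ p) (<:⇒⊴ q)
<:⇒⊴ ♯<:i           = ♯⊴i ≤-refl (⊴-refl _)
<:⇒⊴ ♯<:o           = ♯⊴o ≤-refl (⊴-refl _)
<:⇒⊴ (i<:i p q)     = i⊴i q (<:⇒⊴ p)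
<:⇒⊴ (o<:o p q)     = o⊴o q (<:⇒⊴ p)

-- Local types as lists of levels.

tower : List ℕ → Type
tower []       = 𝕌
tower (k ∷ ks) = chan o k (tower ks)

levels : Type → List ℕ
levels (chan _ k T) = k ∷ levels T
levels 𝕌            = []

-- This is subtyping of towers: `o` is contravariant in its payload, so the comparison changes
-- direction at every level.
data _≼_ : List ℕ → List ℕ → Set where
  []  : [] ≼ []
  _∷_ : ∀ {k l ks ls} → k ≤ l → ls ≼ ks → k ∷ ks ≼ l ∷ ls

≼-refl : ∀ ks → ks ≼ ks
≼-refl []       = []
≼-refl (k ∷ ks) = ≤-refl ∷ ≼-refl ks

≼-trans : ∀ {ks ls ms} → ks ≼ ls → ls ≼ ms → ks ≼ ms
≼-trans []      []      = []
≼-trans (p ∷ d) (q ∷ e) = ≤-trans p q ∷ ≼-trans e d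

≼-length : ∀ {ks ls} → ks ≼ ls → length ks ≡ length ls
≼-length []      = refl
≼-length (_ ∷ d) = cong suc (sym (≼-length d))

_≼?_ : ∀ ks ls → Dec (ks ≼ ls)
[]       ≼? []       = yes []
[]       ≼? (_ ∷ _)  = no λ ()
(_ ∷ _)  ≼? []       = no λ ()
(k ∷ ks) ≼? (l ∷ ls) =
  map′ (uncurry _∷_) (λ { (p ∷ d) → p , d }) (k ≤? l ×-dec ls ≼? ks)

≼⇒<: : ∀ {ks ls} → ks ≼ ls → tower ks <: tower ls
≼⇒<: []      = <:-refl
≼⇒<: (p ∷ d) = o<:o (≼⇒<: d) p

tower-⊴⇒≼ : ∀ ks ls → tower ks ⊴ tower ls → ks ≼ ls
tower-⊴⇒≼ []       []       _         = []
tower-⊴⇒≼ (k ∷ ks) (l ∷ ls) (o⊴o p d) = p ∷ tower-⊴⇒≼ ls ks d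

𝕌-local : LocalType 𝕌
𝕌-local ()

chan-tower-local : ∀ η k ks → LocalType (chan η k (tower ks))
chan-tower-local η k []       (there ())
chan-tower-local η k (l ∷ ls) here      = refl
chan-tower-local η k (l ∷ ls) (there p) = chan-tower-local o l ls p

tower-local : ∀ ks → LocalType (tower ks)
tower-local []       = 𝕌-local
tower-local (k ∷ ks) = chan-tower-local o k ks

-- Locality at the outermost pair forces the payload to be an `o`-type or `𝕌`, and the inner pairs
-- are handled by recursion.
payload-tower : ∀ {η k} T → LocalType (chan η k T) → T ≡ tower (levels T)
payload-tower 𝕌              L = refl
payload-tower (chan η′ k′ T) L with refl ← L here =
  cong (chan o k′) (payload-tower T (L ∘ there))

⊴-tower⇒≼ : ∀ {S} ks → LocalType S → S ⊴ tower ks → levels S ≼ ks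
⊴-tower⇒≼ []       L 𝕌⊴𝕌 = []
⊴-tower⇒≼ (k ∷ ks) L (♯⊴o {T = T} p d) =
  p ∷ tower-⊴⇒≼ ks (levels T) (subst (tower ks ⊴_) (payload-tower T L) d)
⊴-tower⇒≼ (k ∷ ks) L (o⊴o {T = T} p d) =
  p ∷ tower-⊴⇒≼ ks (levels T) (subst (tower ks ⊴_) (payload-tower T L) d)

-- A local type is determined by its levels and one bit: whether the name may
-- be used for input. A name bound by an input has an o-type or 𝕌, so it may not;
-- all others may be taken to be of ♯-type or 𝕌.
Sort : Set
Sort = Bool × List ℕ

toType : Sort → Type
toType (true  , k ∷ ks) = chan ♯ k (tower ks)
toType (true  , [])     = 𝕌
toType (false , ks)     = tower ks

toType-local : ∀ s → LocalType (toType s)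
toType-local (true  , k ∷ ks) = chan-tower-local ♯ k ks
toType-local (true  , [])     = 𝕌-local
toType-local (false , ks)     = tower-local ks

toType-<: : ∀ f {ks ls} → ks ≼ ls → toType (f , ks) <: tower ls
toType-<: true  []      = <:-refl
toType-<: true  (p ∷ d) = <:-trans ♯<:o (≼⇒<: (p ∷ d))
toType-<: false d       = ≼⇒<: d

-- Updates of contexts and environments.

_[_≔_] : ∀ {A : Set} → (Name → A) → Name → A → Name → A
(f [ x ≔ e ]) b = if does (b ≟ x) then e else f b

-- `Γ ▷ x ∶ T` unfolds to the same conditional, so one case split treats an environment and a
-- context side by side.
≔-elim : ∀ {A B : Set} (R : A → B → Set) {f : Name → A} {g : Name → B} {x e e′} b →
         (b ≡ x → R e e′) → (b ≢ x → R (f b) (g b)) →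
         R ((f [ x ≔ e ]) b) ((g [ x ≔ e′ ]) b)
≔-elim R {f} {g} {x} {e} {e′} b eq neq = go (b ≟ x)
  where
  go : (d : Dec (b ≡ x)) → R (if does d then e else f b) (if does d then e′ else g b)
  go (yes p) = eq p
  go (no ¬p) = neq ¬p

≔-elim₁ : ∀ {A : Set} (R : A → Set) {f : Name → A} {x e} b →
          (b ≡ x → R e) → (b ≢ x → R (f b)) → R ((f [ x ≔ e ]) b)
≔-elim₁ R {f} {e = e} b = ≔-elim (λ s _ → R s) {f} {f} {e′ = e} b

-- Syntax-directed checking.

Ctx : Set
Ctx = Name → Sort

valLevels : Ctx → Value → List ℕ
valLevels Δ ⋆        = []
valLevels Δ (name b) = proj₂ (Δ b)

-- W bounds the weight of the process, and C restricts the levels guessed at a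
-- restriction. Shadowing is allowed, and an input binder gets exactly the
-- payload of its channel, the least possible type.
data Checks (C : Pred (List ℕ) 0ℓ) (W : ℕ) (Δ : Ctx) : Process → Set where
  c-nil : Checks C W Δ 𝟎
  c-par : ∀ {P Q} → Checks C W Δ P → Checks C W Δ Q → Checks C W Δ (P ∥ Q)
  c-out : ∀ {a v f k ks} → Δ a ≡ (f , k ∷ ks) → k ≤ W → valLevels Δ v ≼ ks →
          Checks C W Δ (out a v)
  c-inp : ∀ {a x k ks P} → Δ a ≡ (true , k ∷ ks) →
          Checks C W (Δ [ x ≔ (false , ks) ]) P → Checks C W Δ (inp a x P)
  c-rep : ∀ {a x k ks P} → Δ a ≡ (true , suc k ∷ ks) →
          Checks C k (Δ [ x ≔ (false , ks) ]) P → Checks C W Δ (rep a x P)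
  c-res : ∀ {a ks P} → C ks →
          Checks C W (Δ [ a ≔ (true , ks) ]) P → Checks C W Δ (ν a P)

-- The index `W` is only an upper bound, while a typing derivation carries an exact weight.
weight : ∀ {C W Δ P} → Checks C W Δ P → ℕ
weight c-nil                 = 0
weight (c-par c d)           = weight c ⊔ weight d
weight (c-out {k = k} _ _ _) = k
weight (c-inp _ c)           = weight c
weight (c-rep _ _)           = 0
weight (c-res _ c)           = weight c

weight≤ : ∀ {C W Δ P} (c : Checks C W Δ P) → weight c ≤ W
weight≤ c-nil         = z≤n
weight≤ (c-par c d)   = ⊔-lub (weight≤ c) (weight≤ d)
weight≤ (c-out _ p _) = p
weight≤ (c-inp _ c)   = weight≤ c
weight≤ (c-rep _ _)   = z≤n
weight≤ (c-res _ c)   = weight≤ c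

-- Soundness

Unique-++⁻ : ∀ (xs : List Name) {ys} → Unique (xs ++ ys) → Unique xs × Unique ys
Unique-++⁻ []       u       = [] , u
Unique-++⁻ (x ∷ xs) (p ∷ u) with Unique-++⁻ xs u
... | v , w = ++⁻ˡ xs p ∷ v , w

∈-∖ : ∀ {a x} as → a ∈ as → a ≢ x → a ∈ as ∖ x
∈-∖ {x = x} as = ∈-filter⁺ (λ b → ¬? (b ≟ x))

▷-local : ∀ {Γ x T} → LocalEnv Γ → LocalType T → LocalEnv (Γ ▷ x ∶ T)
▷-local {Γ} {x} {T} L M {a} = ≔-elim₁ (λ m → ∀ {S} → m ≡ just S → LocalType S) {f = Γ} a
  (λ { _ refl → M }) (λ _ → L)

▷-fresh : ∀ {Γ x T as} → All (x ≢_) as → (∀ {b} → b ∈ as → b ∉dom Γ) →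
          ∀ {b} → b ∈ as → b ∉dom (Γ ▷ x ∶ T)
▷-fresh {Γ} x∉ F {b} b∈ = ≔-elim₁ (_≡ nothing) {f = Γ} b
  (λ b≡x → contradiction (sym b≡x) (All.lookup x∉ b∈)) (λ _ → F b∈)

▷-realises : ∀ {Γ Δ x s} as → (∀ {b} → b ∈ as ∖ x → Γ b ≡ just (toType (Δ b))) →
             ∀ {b} → b ∈ as → (Γ ▷ x ∶ toType s) b ≡ just (toType ((Δ [ x ≔ s ]) b))
▷-realises {Γ} {Δ} as E {b} b∈ = ≔-elim (λ m s → m ≡ just (toType s)) {Γ} {Δ} b
  (λ _ → refl) (λ b≢x → E (∈-∖ as b∈ b≢x))

sound-name : ∀ {Γ b ls} s → LocalEnv Γ → Γ b ≡ just (toType s) → proj₂ s ≼ ls →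
             Σ[ d ∈ Γ ⊢ᵛ name b ∶ tower ls ] Localᵛ d
sound-name {ls = ls} (f , ks) L eq d =
  t-sub (t-name eq) (toType-<: f d) , L , tower-local ls , L , toType-local (f , ks)

sound-value : ∀ {Γ Δ ls} v → LocalEnv Γ → (∀ {b} → b ∈ fnᵛ v → Γ b ≡ just (toType (Δ b))) →
              valLevels Δ v ≼ ls → Σ[ d ∈ Γ ⊢ᵛ v ∶ tower ls ] Localᵛ d
sound-value         ⋆        L E [] = t-star , L , 𝕌-local
sound-value {Δ = Δ} (name b) L E d  = sound-name (Δ b) L (E (here refl)) d

sound-input : ∀ {Γ a s k ks} → LocalEnv Γ → Γ a ≡ just (toType s) → s ≡ (true , k ∷ ks) →
              Σ[ d ∈ Γ ⊢ᵛ name a ∶ chan i k (tower ks) ] Localᵛ d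
sound-input {k = k} {ks} L eq refl =
  t-sub (t-name eq) ♯<:i , L , chan-tower-local i k ks , L , chan-tower-local ♯ k ks

-- `Γ` and `Δ` are compared on free names only, because `Γ` has to stay undefined at the binders
-- while `Δ` is total. Distinctness of the binders keeps the remaining ones fresh after each
-- extension.
sound : ∀ {C W Γ Δ} P → Unique (bn P) → (∀ {x} → x ∈ bn P → x ∉dom Γ) → LocalEnv Γ →
        (∀ {a} → a ∈ fn P → Γ a ≡ just (toType (Δ a))) →
        (c : Checks C W Δ P) → Γ ⊢ᴸ P ∶ weight c
sound 𝟎 u F L E c-nil = t-nil , L
sound (P ∥ Q) u F L E (c-par c d)
  with Unique-++⁻ (bn P) u
... | uP , uQ with sound P uP (F ∘ ∈-++⁺ˡ) L (E ∘ ∈-++⁺ˡ) c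
                 | sound Q uQ (F ∘ ∈-++⁺ʳ (bn P)) L (E ∘ ∈-++⁺ʳ (fn P)) d
... | dP , lP | dQ , lQ = t-par dP dQ , L , lP , lQ
sound {Δ = Δ} (out a v) u F L E (c-out {k = k} {ks} eq _ d)
  with sound-name (Δ a) L (E (here refl)) (subst (_≼ k ∷ ks) (sym (cong proj₂ eq)) (≼-refl (k ∷ ks)))
     | sound-value v L (E ∘ there) d
... | da , la | dv , lv = t-out da dv , L , la , lv
sound {Γ = Γ} {Δ} (inp a x P) (x∉ ∷ u) F L E (c-inp {ks = ks} eq c)
  with sound-input L (E (here refl)) eq
     | sound P u (▷-fresh {Γ} x∉ (F ∘ there)) (▷-local {Γ} L (tower-local ks))
         (▷-realises {Γ} {Δ} {s = false , ks} (fn P) (E ∘ there)) c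
... | da , la | dP , lP = t-inp da (F (here refl)) dP , L , la , lP
sound {Γ = Γ} {Δ} (rep a x P) (x∉ ∷ u) F L E (c-rep {ks = ks} eq c)
  with sound-input L (E (here refl)) eq
     | sound P u (▷-fresh {Γ} x∉ (F ∘ there)) (▷-local {Γ} L (tower-local ks))
         (▷-realises {Γ} {Δ} {s = false , ks} (fn P) (E ∘ there)) c
-- The channel has level `suc k` and the body is checked with bound `k`, hence the strict
-- inequality.
... | da , la | dP , lP = t-rep da (F (here refl)) dP (s≤s (weight≤ c)) , L , la , lP
sound {Γ = Γ} {Δ} (ν a P) (a∉ ∷ u) F L E (c-res {ks = ks} _ c)
  with sound P u (▷-fresh {Γ} a∉ (F ∘ there)) (▷-local {Γ} L (toType-local (true , ks)))
         (▷-realises {Γ} {Δ} (fn P) E) c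
... | dP , lP = t-res (F (here refl)) dP , L , lP

-- Completeness

-- How a type in a derivation is replaced. Free and restricted names keep their levels and gain the
-- capability `♯`; a name bound by an input may receive a subtype, namely the payload of its
-- channel.
data _↝_ : Type → Sort → Set where
  exact : ∀ {S} → S ↝ (true , levels S)
  below : ∀ {ks ls} → ks ≼ ls → tower ls ↝ (false , ks)

↝-tower : ∀ {S s} ks → S ↝ s → LocalType S → S ⊴ tower ks → proj₂ s ≼ ks
↝-tower ks exact              L d = ⊴-tower⇒≼ ks L d
↝-tower ks (below {ls = ls} p) L d = ≼-trans p (tower-⊴⇒≼ ls ks d)

-- Input is covariant, so the payload of `S` is a subtype of `T`, which is what `below` asks. A
-- tower is never below an `i`-type, which excludes names bound by an input.
↝-input : ∀ {S s l T} → S ↝ s → LocalType S → LocalType (chan i l T) → S ⊴ chan i l T →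
          ∃₂ λ k ks → s ≡ (true , k ∷ ks) × l ≤ k × T ↝ (false , ks)
↝-input {T = T} exact L M (♯⊴i {T = R} p d) = _ , _ , refl , p ,
  subst (_↝ _) (sym (payload-tower T M))
    (below (tower-⊴⇒≼ _ _ (subst (λ X → X ⊴ tower (levels T)) (payload-tower R L)
      (subst (R ⊴_) (payload-tower T M) d))))
↝-input {T = T} exact L M (i⊴i {T = R} p d) = _ , _ , refl , p ,
  subst (_↝ _) (sym (payload-tower T M))
    (below (tower-⊴⇒≼ _ _ (subst (λ X → X ⊴ tower (levels T)) (payload-tower R L)
      (subst (R ⊴_) (payload-tower T M) d))))
↝-input (below {ls = []}    _) L M ()
↝-input (below {ls = _ ∷ _} _) L M ()

Localᵛ⇒LocalType : ∀ {Γ v T} (d : Γ ⊢ᵛ v ∶ T) → Localᵛ d → LocalType T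
Localᵛ⇒LocalType t-star      (_ , M)     = M
Localᵛ⇒LocalType (t-name _)  (_ , M)     = M
Localᵛ⇒LocalType (t-sub _ _) (_ , M , _) = M

⊢ᵛ-name⁻ : ∀ {Γ a T} → Γ ⊢ᵛ name a ∶ T → ∃ λ S → Γ a ≡ just S × S ⊴ T
⊢ᵛ-name⁻ (t-name eq)  = _ , eq , ⊴-refl _
⊢ᵛ-name⁻ (t-sub d p) with ⊢ᵛ-name⁻ d
... | S , eq , q = S , eq , ⊴-trans q (<:⇒⊴ p)

_∣_↝_ : List Name → Env → Ctx → Set
as ∣ Γ ↝ Δ = ∀ {a S} → a ∈ as → Γ a ≡ just S → S ↝ Δ a

▷-↝ : ∀ {Γ Δ x T s} as → (as ∖ x) ∣ Γ ↝ Δ → T ↝ s → as ∣ (Γ ▷ x ∶ T) ↝ (Δ [ x ≔ s ])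
▷-↝ {Γ} {Δ} as A p {a} a∈ = ≔-elim (λ m s → ∀ {S} → m ≡ just S → S ↝ s) {Γ} {Δ} a
  (λ { _ refl → p }) (λ a≢x → A (∈-∖ as a∈ a≢x))

valLevels-≼ : ∀ {Γ Δ v} ls → LocalEnv Γ → fnᵛ v ∣ Γ ↝ Δ → Γ ⊢ᵛ v ∶ tower ls →
              valLevels Δ v ≼ ls
valLevels-≼ {v = name b} ls L A d with ⊢ᵛ-name⁻ d
... | S , eq , q = ↝-tower ls (A (here refl) eq) (L eq) q
valLevels-≼ {v = ⋆} []      L A t-star = []
valLevels-≼ {v = ⋆} (_ ∷ _) L A ()

Local⇒LocalEnv : ∀ {Γ P w} (d : Γ ⊢ P ∶ w) → Local d → LocalEnv Γ
Local⇒LocalEnv t-nil           L       = L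
Local⇒LocalEnv (t-out _ _)     (L , _) = L
Local⇒LocalEnv (t-inp _ _ _)   (L , _) = L
Local⇒LocalEnv (t-rep _ _ _ _) (L , _) = L
Local⇒LocalEnv (t-res _ _)     (L , _) = L
Local⇒LocalEnv (t-par _ _)     (L , _) = L

subject-input : ∀ {Γ Δ a l T as} → LocalEnv Γ → a ∷ as ∣ Γ ↝ Δ →
                (d : Γ ⊢ᵛ name a ∶ chan i l T) → Localᵛ d →
                ∃₂ λ k ks → Δ a ≡ (true , k ∷ ks) × l ≤ k × T ↝ (false , ks)
subject-input L A d M with ⊢ᵛ-name⁻ d
... | S , eq , q = ↝-input (A (here refl) eq) (L eq) (Localᵛ⇒LocalType d M) q

-- Each restriction guesses the levels of its type in the derivation. Undoing subsumption can only
-- lower the level of an output and raise that of an input, so the bounds survive.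
complete : ∀ {Γ Δ P w W} (d : Γ ⊢ P ∶ w) → Local d → w ≤ W → fn P ∣ Γ ↝ Δ → Checks U W Δ P
complete t-nil L p A = c-nil
complete {P = P ∥ Q} (t-par {w₁ = w₁} {w₂} d e) (_ , L , M) p A =
  c-par (complete d L (≤-trans (m≤m⊔n w₁ w₂) p) (A ∘ ∈-++⁺ˡ))
        (complete e M (≤-trans (m≤n⊔m w₁ w₂) p) (A ∘ ∈-++⁺ʳ (fn P)))
complete {Γ} {Δ} {out a v} (t-out {k = k} {T} d e) (L , M , N) p A
  with ⊢ᵛ-name⁻ d
... | S , eq , q
  with Δ a in eqΔ
     | ↝-tower (k ∷ levels T) (A (here refl) eq) (L eq)
         (subst (λ X → S ⊴ chan o k X) (payload-tower T (Localᵛ⇒LocalType d M)) q)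
... | f , l ∷ ls | l≤k ∷ r = c-out eqΔ (≤-trans l≤k p)
  (≼-trans (valLevels-≼ (levels T) L (A ∘ there)
             (subst (Γ ⊢ᵛ v ∶_) (payload-tower T (Localᵛ⇒LocalType d M)) e)) r)
complete {Γ} {Δ} {inp a x P} (t-inp d _ e) (L , M , N) p A
  with subject-input {Γ} {Δ} L A d M
... | k , ks , eq , _ , r = c-inp eq (complete e N p (▷-↝ {Γ} {Δ} (fn P) (A ∘ there) r))
complete {Γ} {Δ} {rep a x P} (t-rep d _ e w<l) (L , M , N) p A
  with subject-input {Γ} {Δ} L A d M
... | k , ks , eq , l≤k , r with ≤-trans w<l l≤k
-- A level strictly above `w` is a successor, and its predecessor bounds the weight of the body.
... | s≤s w≤k = c-rep eq (complete e N w≤k (▷-↝ {Γ} {Δ} (fn P) (A ∘ there) r))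
complete {Γ} {Δ} {ν a P} (t-res _ d) (_ , L) p A =
  c-res _ (complete d L p (▷-↝ {Γ} {Δ} (fn P) A exact))

-- The small model property

rank : List ℕ → ℕ → ℕ
rank L zero    = 0
rank L (suc n) = if does (n ∈? L) then suc (rank L n) else rank L n

rank-suc : ∀ {L n} → n ∈ L → rank L (suc n) ≡ suc (rank L n)
rank-suc {L} {n} n∈ with n ∈? L
... | yes _  = refl
... | no n∉ = contradiction n∈ n∉

rank-suc-∉ : ∀ {L n} → ¬ n ∈ L → rank L (suc n) ≡ rank L n
rank-suc-∉ {L} {n} n∉ with n ∈? L
... | yes n∈ = contradiction n∈ n∉
... | no _   = refl

rank-≤-suc : ∀ L n → rank L n ≤ rank L (suc n)
rank-≤-suc L n with n ∈? L
... | yes _ = m≤n⇒m≤1+n ≤-refl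
... | no _  = ≤-refl

rank-mono : ∀ L {m n} → m ≤ n → rank L m ≤ rank L n
rank-mono L p = go (≤⇒≤′ p)
  where
  go : ∀ {m n} → m ≤′ n → rank L m ≤ rank L n
  go ≤′-refl             = ≤-refl
  go (≤′-step {n = n} q) = ≤-trans (go q) (rank-≤-suc L n)

-- Only numbers strictly below `n` are counted, and `x` is not one of them.
rank-∷-below : ∀ x L {n} → n ≤ x → rank (x ∷ L) n ≤ rank L n
rank-∷-below x L {zero}  p = z≤n
rank-∷-below x L {suc n} p = case n ∈? L of λ
  { (yes n∈) → begin
      rank (x ∷ L) (suc n)  ≡⟨ rank-suc {x ∷ L} (there n∈) ⟩
      suc (rank (x ∷ L) n)  ≤⟨ s≤s (rank-∷-below x L (<⇒≤ p)) ⟩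
      suc (rank L n)        ≡⟨ rank-suc n∈ ⟨
      rank L (suc n)        ∎
  ; (no n∉) → begin
      rank (x ∷ L) (suc n)  ≡⟨ rank-suc-∉ {x ∷ L} (λ { (here n≡x) → <⇒≢ p n≡x ; (there n∈) → n∉ n∈ }) ⟩
      rank (x ∷ L) n        ≤⟨ rank-∷-below x L (<⇒≤ p) ⟩
      rank L n              ≤⟨ rank-≤-suc L n ⟩
      rank L (suc n)        ∎
  }
  where open ≤-Reasoning

-- The new element counts at most once, in the step from `x` to `suc x`; up to `x` the previous
-- lemma applies.
rank-∷ : ∀ x L n → rank (x ∷ L) n ≤ suc (rank L n)
rank-∷ x L zero    = z≤n
rank-∷ x L (suc n) = case ((n ∈? L) , (n ≟ x)) of λ
  { (yes n∈ , _) → begin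
      rank (x ∷ L) (suc n)  ≡⟨ rank-suc {x ∷ L} (there n∈) ⟩
      suc (rank (x ∷ L) n)  ≤⟨ s≤s (rank-∷ x L n) ⟩
      suc (suc (rank L n))  ≡⟨ cong suc (rank-suc n∈) ⟨
      suc (rank L (suc n))  ∎
  ; (no _ , yes refl) → begin
      rank (x ∷ L) (suc n)  ≡⟨ rank-suc {x ∷ L} (here refl) ⟩
      suc (rank (x ∷ L) n)  ≤⟨ s≤s (rank-∷-below x L ≤-refl) ⟩
      suc (rank L n)        ≤⟨ s≤s (rank-≤-suc L n) ⟩
      suc (rank L (suc n))  ∎
  ; (no n∉ , no n≢x) → begin
      rank (x ∷ L) (suc n)  ≡⟨ rank-suc-∉ {x ∷ L} (λ { (here n≡x) → n≢x n≡x ; (there n∈) → n∉ n∈ }) ⟩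
      rank (x ∷ L) n        ≤⟨ rank-∷ x L n ⟩
      suc (rank L n)        ≤⟨ s≤s (rank-≤-suc L n) ⟩
      suc (rank L (suc n))  ∎
  }
  where open ≤-Reasoning

rank-[] : ∀ n → rank [] n ≡ 0
rank-[] zero    = refl
rank-[] (suc n) = rank-[] n

rank≤length : ∀ L n → rank L n ≤ length L
rank≤length []      n = ≤-reflexive (rank-[] n)
rank≤length (x ∷ L) n = ≤-trans (rank-∷ x L n) (s≤s (rank≤length L n))

compress : List ℕ → List ℕ → List ℕ
compress L ks = map (rank L) (take (rank L (length ks)) ks)

-- Since the payload depth lies in `L`, the channel is cut exactly one level deeper than its
-- payload, so compression commutes with taking the payload.
compress-∷ : ∀ {L ks} k → length ks ∈ L → compress L (k ∷ ks) ≡ rank L k ∷ compress L ks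
compress-∷ {L} {ks} k p =
  cong (λ n → map (rank L) (take n (k ∷ ks))) (rank-suc p)

rank-take-mono : ∀ L n {ks ls} → ks ≼ ls → map (rank L) (take n ks) ≼ map (rank L) (take n ls)
rank-take-mono L zero    d       = []
rank-take-mono L (suc n) []      = []
rank-take-mono L (suc n) (p ∷ d) = rank-mono L p ∷ rank-take-mono L n d

compress-mono : ∀ L {ks ls} → ks ≼ ls → compress L ks ≼ compress L ls
compress-mono L {ks} {ls} d =
  -- Related lists have equal length, so both are cut at the same depth.
  subst (λ n → compress L ks ≼ map (rank L) (take (rank L n) ls)) (≼-length d)
    (rank-take-mono L (rank L (length ks)) d)

Bounded : ℕ → ℕ → Pred (List ℕ) 0ℓ
Bounded N B ks = length ks ≤ N × All (_< B) ks

compress-bounded : ∀ L ks → Bounded (length L) (suc (length L)) (compress L ks)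
compress-bounded L ks =
    ≤-trans (≤-reflexive (trans (length-map (rank L) (take d ks)) (length-take d ks)))
      (≤-trans (m⊓n≤m d (length ks)) (rank≤length L (length ks)))
  , map⁺ (All.universal (λ k → s≤s (rank≤length L k)) (take d ks))
  where d = rank L (length ks)

-- The numbers at which compression must preserve the successor: payload depths,
-- and for a replication on a channel of level suc k the weight bound k of its body.
critical : ∀ {C W Δ P} → Checks C W Δ P → List ℕ
critical c-nil                   = []
critical (c-par c d)             = critical c ++ critical d
critical (c-out {ks = ks} _ _ _) = [ length ks ]
critical (c-inp {ks = ks} _ c)   = length ks ∷ critical c
critical (c-rep {k = k} {ks} _ c) = length ks ∷ k ∷ critical c
critical (c-res _ c)             = critical c

-- Counts the critical numbers without a derivation, so that the search space is computable from the
-- process alone. A replication contributes two.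
size : Process → ℕ
size 𝟎           = 0
size (P ∥ Q)     = size P + size Q
size (out a v)   = 1
size (ν a P)     = size P
size (inp a x P) = suc (size P)
size (rep a x P) = suc (suc (size P))

length-critical : ∀ {C W Δ P} (c : Checks C W Δ P) → length (critical c) ≡ size P
length-critical c-nil         = refl
length-critical (c-par c d)   = trans (length-++ (critical c))
                                      (cong₂ _+_ (length-critical c) (length-critical d))
length-critical (c-out _ _ _) = refl
length-critical (c-inp _ c)   = cong suc (length-critical c)
length-critical (c-rep _ c)   = cong (suc ∘ suc) (length-critical c)
length-critical (c-res _ c)   = length-critical c

CompressedBy : List ℕ → Ctx → Ctx → Set
CompressedBy L Δ Δ′ = ∀ b → Δ′ b ≡ map₂ (compress L) (Δ b)

≔-compressed : ∀ {L Δ Δ′ x f ks} → CompressedBy L Δ Δ′ →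
               CompressedBy L (Δ [ x ≔ (f , ks) ]) (Δ′ [ x ≔ (f , compress L ks) ])
≔-compressed {L} {Δ} {Δ′} E b =
  ≔-elim (λ s s′ → s′ ≡ map₂ (compress L) s) {Δ} {Δ′} b (λ _ → refl) (λ _ → E b)

valLevels-compressed : ∀ {L Δ Δ′} → CompressedBy L Δ Δ′ →
                       ∀ v → valLevels Δ′ v ≡ compress L (valLevels Δ v)
valLevels-compressed E ⋆        = refl
valLevels-compressed E (name b) = cong proj₂ (E b)

-- Comparisons survive by monotonicity, and the splitting of a channel into level and payload by
-- `compress-∷`. One `L` serves the whole derivation, hence the inclusion instead of an equality.
compress-checks : ∀ {C L W Δ Δ′ P} (c : Checks C W Δ P) → critical c ⊆ L →
                  CompressedBy L Δ Δ′ →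
                  Checks (Bounded (length L) (suc (length L))) (rank L W) Δ′ P
compress-checks c-nil sub E = c-nil
compress-checks (c-par c d) sub E =
  c-par (compress-checks c (sub ∘ ∈-++⁺ˡ) E)
        (compress-checks d (sub ∘ ∈-++⁺ʳ (critical c)) E)
compress-checks {L = L} {Δ = Δ} (c-out {a} {v} {f} {k} {ks} eq p d) sub E =
  c-out (trans (E a) (trans (cong (map₂ (compress L)) eq)
                            (cong (f ,_) (compress-∷ k (sub (here refl))))))
        (rank-mono L p)
        (subst (_≼ compress L ks) (sym (valLevels-compressed {Δ = Δ} E v)) (compress-mono L d))
compress-checks {L = L} {Δ = Δ} (c-inp {a} {k = k} eq c) sub E =
  c-inp (trans (E a) (trans (cong (map₂ (compress L)) eq)
                            (cong (true ,_) (compress-∷ k (sub (here refl))))))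
        (compress-checks c (sub ∘ there) (≔-compressed {Δ = Δ} E))
compress-checks {L = L} {Δ = Δ} (c-rep {a} {k = k} {ks} eq c) sub E =
  -- Here `length ks` being in `L` preserves the payload, and `k` being in `L` keeps the level a
  -- successor, whose predecessor `rank L k` is the new bound of the body.
  c-rep (trans (E a) (trans (cong (map₂ (compress L)) eq)
                            (cong (true ,_) (trans (compress-∷ (suc k) (sub (here refl)))
                              (cong (_∷ compress L ks) (rank-suc (sub (there (here refl)))))))))
        (compress-checks c (λ n∈ → sub (there (there n∈))) (≔-compressed {Δ = Δ} E))
compress-checks {L = L} {Δ = Δ} (c-res {ks = ks} _ c) sub E =
  c-res (compress-bounded L ks) (compress-checks c sub (≔-compressed {Δ = Δ} E))

-- The decision procedure

bounded? : ∀ N B {Q : Pred (List ℕ) 0ℓ} → Decidable Q → Dec (∃ λ ks → Bounded N B ks × Q ks)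
bounded? zero    B Q? =
  map′ (λ q → [] , (z≤n , []) , q) (λ { ([] , _ , q) → q }) (Q? [])
bounded? (suc N) B {Q} Q? with Q? []
... | yes q = yes ([] , (z≤n , []) , q)
... | no ¬q = map′ to from
                (anyUpTo? (λ k → bounded? N B (λ ks → Q? (k ∷ ks))) B)
  where
  to : (∃ λ k → k < B × ∃ λ ks → Bounded N B ks × Q (k ∷ ks)) →
       ∃ λ ks → Bounded (suc N) B ks × Q ks
  to (k , p , ks , (n , b) , q) = k ∷ ks , (s≤s n , p ∷ b) , q

  from : (∃ λ ks → Bounded (suc N) B ks × Q ks) →
         ∃ λ k → k < B × ∃ λ ks → Bounded N B ks × Q (k ∷ ks)
  from ([]     , _                , q) = contradiction q ¬q
  from (k ∷ ks , (s≤s n , p ∷ b) , q) = k , p , ks , (n , b) , q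

-- `Δ` determines the instance of every rule except `c-res`, so only the levels at restrictions are
-- searched.
checks? : ∀ N B W Δ P → Dec (Checks (Bounded N B) W Δ P)
checks? N B W Δ 𝟎       = yes c-nil
checks? N B W Δ (P ∥ Q) =
  map′ (uncurry c-par) (λ { (c-par c d) → c , d }) (checks? N B W Δ P ×-dec checks? N B W Δ Q)
checks? N B W Δ (out a v) with Δ a in eq
... | f , []     = no λ { (c-out eq′ _ _) → case trans (sym eq) eq′ of λ () }
... | f , k ∷ ks = map′ (λ { (p , d) → c-out eq p d })
                        (λ { (c-out eq′ p d) → case trans (sym eq) eq′ of λ { refl → p , d } })
                        (k ≤? W ×-dec valLevels Δ v ≼? ks)
checks? N B W Δ (ν a P) =
  map′ (λ { (_ , b , c) → c-res b c }) (λ { (c-res b c) → _ , b , c })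
    (bounded? N B (λ ks → checks? N B W (Δ [ a ≔ (true , ks) ]) P))
checks? N B W Δ (inp a x P) with Δ a in eq
... | false , _      = no λ { (c-inp eq′ _) → case trans (sym eq) eq′ of λ () }
... | true  , []     = no λ { (c-inp eq′ _) → case trans (sym eq) eq′ of λ () }
... | true  , k ∷ ks = map′ (c-inp eq)
                            (λ { (c-inp eq′ c) → case trans (sym eq) eq′ of λ { refl → c } })
                            (checks? N B W (Δ [ x ≔ (false , ks) ]) P)
checks? N B W Δ (rep a x P) with Δ a in eq
... | false , _           = no λ { (c-rep eq′ _) → case trans (sym eq) eq′ of λ () }
... | true  , []          = no λ { (c-rep eq′ _) → case trans (sym eq) eq′ of λ () }
... | true  , zero ∷ _    = no λ { (c-rep eq′ _) → case trans (sym eq) eq′ of λ () }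
... | true  , suc k ∷ ks = map′ (c-rep eq)
                                (λ { (c-rep eq′ c) → case trans (sym eq) eq′ of λ { refl → c } })
                                (checks? N B k (Δ [ x ≔ (false , ks) ]) P)

-- Restricting the free names lets the rule for ν guess their types too.
close : List Name → Process → Process
close xs P = foldr ν P xs

∅ : Ctx
∅ _ = true , []

extendAll : Ctx → List Name → (Name → List ℕ) → Ctx
extendAll Δ []       τ = Δ
extendAll Δ (x ∷ xs) τ = extendAll (Δ [ x ≔ (true , τ x) ]) xs τ

-- `fn P` may list a name several times; `τ` depends on the name alone, so a repeated update writes
-- the same sort.
extendAll-stable : ∀ {Δ a} xs τ → Δ a ≡ (true , τ a) → extendAll Δ xs τ a ≡ (true , τ a)
extendAll-stable         []       τ eq = eq
extendAll-stable {Δ} {a} (x ∷ xs) τ eq = extendAll-stable xs τ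
  (≔-elim₁ (_≡ (true , τ a)) {f = Δ} a (λ { refl → refl }) (λ _ → eq))

extendAll-∈ : ∀ {Δ a xs} τ → a ∈ xs → extendAll Δ xs τ a ≡ (true , τ a)
extendAll-∈ {Δ} {a} {xs = x ∷ xs} τ (here refl) = extendAll-stable xs τ
  (≔-elim₁ (_≡ (true , τ a)) {f = Δ} a (λ _ → refl) (λ a≢a → contradiction refl a≢a))
extendAll-∈ τ (there a∈) = extendAll-∈ τ a∈

close⁺ : ∀ {W Δ P} xs τ → Checks U W (extendAll Δ xs τ) P → Checks U W Δ (close xs P)
close⁺ []       τ c = c
close⁺ (x ∷ xs) τ c = c-res _ (close⁺ xs τ c)

close⁻ : ∀ {C W Δ P} xs → Checks C W Δ (close xs P) → ∃ λ Δ′ → Checks C W Δ′ P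
close⁻ []       c           = _ , c
close⁻ (x ∷ xs) (c-res _ c) = close⁻ xs c

closure : Process → Process
closure P = close (fn P) P

bound : Process → ℕ
bound P = size (closure P)

SmallSolution : Process → Set
SmallSolution P =
  ∃ λ W → W < suc (bound P) × Checks (Bounded (bound P) (suc (bound P))) W ∅ (closure P)

smallSolution? : ∀ P → Dec (SmallSolution P)
smallSolution? P =
  anyUpTo? (λ W → checks? (bound P) (suc (bound P)) W ∅ (closure P)) (suc (bound P))

typable⇒smallSolution : ∀ {Γ P w} → Γ ⊢ᴸ P ∶ w → SmallSolution P
typable⇒smallSolution {Γ} {P} {w} (d , L) =
  subst (λ B → ∃ λ W → W < suc B × Checks (Bounded B (suc B)) W ∅ (closure P))
    (length-critical c)
    -- The weight bound is compressed along with the levels. `∅` compresses to itself, as the empty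
    -- list does.
    (rank K w , s≤s (rank≤length K w) , compress-checks c id (λ _ → refl))
  where
  τ : Name → List ℕ
  -- Where `Γ` is undefined the guess is `𝕌`; `types` only speaks of names that `Γ` types.
  τ a = maybe levels [] (Γ a)

  types : fn P ∣ Γ ↝ extendAll ∅ (fn P) τ
  types {a} {S} a∈ eq =
    subst (S ↝_) (sym (trans (extendAll-∈ τ a∈) (cong (λ m → true , maybe levels [] m) eq))) exact

  c : Checks U w ∅ (closure P)
  c = close⁺ (fn P) τ (complete d L ≤-refl types)

  K : List ℕ
  K = critical c

-- Cutting the domain down to the free names leaves the binders of a `WellNamed` process fresh.
envOn : List Name → Ctx → Env
envOn as Δ a = if does (a ∈? as) then just (toType (Δ a)) else nothing

envOn-∈ : ∀ {as a} Δ → a ∈ as → envOn as Δ a ≡ just (toType (Δ a))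
envOn-∈ {as} {a} Δ a∈ with a ∈? as
... | yes _ = refl
... | no a∉ = contradiction a∈ a∉

envOn-∉ : ∀ {as a} Δ → ¬ a ∈ as → envOn as Δ a ≡ nothing
envOn-∉ {as} {a} Δ a∉ with a ∈? as
... | yes a∈ = contradiction a∈ a∉
... | no _   = refl

envOn-local : ∀ as Δ → LocalEnv (envOn as Δ)
envOn-local as Δ {a} eq with a ∈? as
envOn-local as Δ {a} refl | yes _ = toType-local (Δ a)

solve : ∀ P → SmallSolution P → Env × ℕ
solve P (_ , _ , c) with close⁻ (fn P) c
... | Δ , c′ = envOn (fn P) Δ , weight c′

solve-sound : ∀ P → WellNamed P → (s : SmallSolution P) → uncurry (_⊢ᴸ P ∶_) (solve P s)
solve-sound P (u , disj) (_ , _ , c) with close⁻ (fn P) c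
... | Δ , c′ = sound P u (λ x∈ → envOn-∉ Δ (λ x∈fn → disj (x∈ , x∈fn)))
                 (envOn-local (fn P) Δ) (envOn-∈ Δ) c′

-- The inference procedure and its correctness.

infer : Process → Maybe (Env × ℕ)
infer P with smallSolution? P
... | yes s = just (solve P s)
... | no _  = nothing

theorem24 : Σ[ infer ∈ (Process → Maybe (Env × ℕ)) ]
    (∀ P → WellNamed P →
    (∀ Γ w → infer P ≡ just (Γ , w) → Γ ⊢ᴸ P ∶ w)
    × ((∃₂ λ Γ w → infer P ≡ just (Γ , w)) ⇔ (∃₂ λ Γ′ w′ → Γ′ ⊢ᴸ P ∶ w′))
    × (infer P ≡ nothing ⇔ (¬ (∃₂ λ Γ′ w′ → Γ′ ⊢ᴸ P ∶ w′))))
theorem24 = infer , correct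
  where
  correct : ∀ P → WellNamed P →
    (∀ Γ w → infer P ≡ just (Γ , w) → Γ ⊢ᴸ P ∶ w)
    × ((∃₂ λ Γ w → infer P ≡ just (Γ , w)) ⇔ (∃₂ λ Γ′ w′ → Γ′ ⊢ᴸ P ∶ w′))
    × (infer P ≡ nothing ⇔ (¬ (∃₂ λ Γ′ w′ → Γ′ ⊢ᴸ P ∶ w′)))
  correct P wn with smallSolution? P
  ... | yes s = (λ { _ _ refl → solve-sound P wn s })
              , mk⇔ (λ _ → _ , _ , solve-sound P wn s) (λ _ → _ , _ , refl)
              , mk⇔ (λ ()) (λ ¬typable → contradiction (_ , _ , solve-sound P wn s) ¬typable)
  ... | no ¬s = (λ { _ _ () })
              , mk⇔ (λ { (_ , _ , ()) })
                    (λ (_ , _ , d) → contradiction (typable⇒smallSolution d) ¬s)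
              , mk⇔ (λ _ (_ , _ , d) → ¬s (typable⇒smallSolution d)) (λ _ → refl)
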